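{- Let $f(t)\in\mathbb{Q}[t]$ be irreducible of degree $3$. Then there are infinitely many quadratic polynomials $g(y)\in\mathbb{Q}[y]$ for which $f(g(y))$ is reducible in $\mathbb{Q}[y]$, and which are pairwise distinct under transformations replacing $y$ by a polynomial in $y$ (that is, no one of them is obtained from another by substituting a polynomial $p(y)\in\mathbb{Q}[y]$ for $y$). -}

module Defs where

open import Algebra.Bundles.Raw using (RawSemiring)
import Algebra.Definitions.RawSemiring
open import Data.List.Base using (List; []; _∷_; map)
open import Data.Nat.Base as ℕ using (ℕ; zero; suc)
open import Data.Product.Base using (∃₂; _×_)
open import Data.Rational.Base as ℚ using (ℚ; 0ℚ; 1ℚ)
open import Level using (0ℓ)
open import Relation.Binary.PropositionalEquality.Core using (_≡_; _≢_)

-- A univariate polynomial over ℚ is a list of coefficients, constant term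
-- first.  Trailing zeros are allowed, so polynomials are compared with _≈_
-- and never with _≡_.

ℚ[X] : Set
ℚ[X] = List ℚ

coeff : ℚ[X] → ℕ → ℚ
coeff []      n       = 0ℚ
coeff (a ∷ p) zero    = a
coeff (a ∷ p) (suc n) = coeff p n

infix 4 _≈_
_≈_ : ℚ[X] → ℚ[X] → Set
p ≈ q = ∀ n → coeff p n ≡ coeff q n

infixl 6 _+_
_+_ : ℚ[X] → ℚ[X] → ℚ[X]
[]      + q       = q
(a ∷ p) + []      = a ∷ p
(a ∷ p) + (b ∷ q) = (a ℚ.+ b) ∷ (p + q)

-- (a + X p) q = a q + X (p q)
infixl 7 _*_
_*_ : ℚ[X] → ℚ[X] → ℚ[X]
[]      * q = []
(a ∷ p) * q = map (a ℚ.*_) q + (0ℚ ∷ (p * q))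

ℚ[X]-rawSemiring : RawSemiring 0ℓ 0ℓ
ℚ[X]-rawSemiring = record
  { Carrier = ℚ[X]
  ; _≈_     = _≈_
  ; _+_     = _+_
  ; _*_     = _*_
  ; 0#      = []
  ; 1#      = 1ℚ ∷ []
  }

open RawSemiring ℚ[X]-rawSemiring public using (_≉_; 0#; 1#)
open Algebra.Definitions.RawSemiring ℚ[X]-rawSemiring public
  using (_∣_; _∤_; Irreducible)

-- p ⟨ q ⟩ is the composite p(q(X)), by Horner's rule.
infixl 8 _⟨_⟩
_⟨_⟩ : ℚ[X] → ℚ[X] → ℚ[X]
[]      ⟨ q ⟩ = []
(a ∷ p) ⟨ q ⟩ = (a ∷ []) + q * (p ⟨ q ⟩)

HasDegree : ℚ[X] → ℕ → Set
HasDegree p n = coeff p n ≢ 0ℚ × (∀ {m} → n ℕ.< m → coeff p m ≡ 0ℚ)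

-- A nonzero product of two non-units, with the factorization as data.
Reducible : ℚ[X] → Set
Reducible p = p ≉ 0# × ∃₂ λ a b → a ∤ 1# × b ∤ 1# × p ≈ a * b

{-# OPTIONS --safe #-}
module Submission where

-- Divide f by its leading coefficient d to get m = a + bt + ct² + t³, and let
-- m(k + s) = A + Bs + Cs² + s³.  If α is a root of m, then β = 1/(α − k) is a
-- root of H = 1 + Cy + By² + Ay³, and solving H(β) = 0 for 1/β = α − k gives
-- α = g(β) with g = k − C − By − Ay².  Hence H divides m(g), and this gives one
-- quadratic g for each k.
--
-- Suppose the quadratics of i ≠ j satisfy g_i = g_j(v + uy).  Then v + u/(α − i)
-- is one of the two roots of g_j = α, that is β or − B/A − β with β = 1/(α − j).
-- With denominators cleared the two alternatives become quadratics q₁(α) = 0 and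
-- q₂(α) = 0, and q₁q₂ is a nonzero multiple of (2t − i − j) m(t).  So one of
-- q₁, q₂ vanishes at the midpoint of i and j, and its other root is a rational
-- root of m.

open import Defs
open import Algebra.Bundles.Raw using (RawRing)
open import Algebra.Definitions.RawMagma using (_,_)
import Algebra.Definitions.RawSemiring
import Algebra.Properties.Group as GroupProperties
open import Data.Empty using (⊥)
open import Data.Integer.Base using (+_)
open import Data.Integer.Properties using (+-injective)
open import Data.List.Base using (List; []; _∷_; map)
open import Data.Nat.Base as ℕ using (ℕ; zero; suc; z≤n; s≤s)
import Data.Nat.Coprimality as Coprimality
import Data.Nat.Properties as ℕ
open import Data.Product.Base using (∃; _×_; _,_; proj₁; proj₂)
open import Data.Rational.Base as ℚ using (ℚ; 0ℚ; 1ℚ; mkℚ; ↥_)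
import Data.Rational.Properties as ℚ
open import Data.Rational.Solver using (module +-*-Solver)
open import Data.Sum.Base using (_⊎_; inj₁; inj₂; [_,_])
open import Function.Base using (_∘_)
open import Level using (0ℓ)
open import Relation.Binary.Definitions using (tri<; tri≈; tri>)
open import Relation.Binary.PropositionalEquality
  using (_≡_; refl; sym; trans; cong; cong₂; subst; module ≡-Reasoning)
open import Relation.Binary.PropositionalEquality.Core using (_≢_)
open import Relation.Nullary.Decidable.Core using (yes; no)
open import Relation.Nullary.Negation.Core using (¬_; contradiction)

open GroupProperties ℚ.+-0-group
  using (x∙y⁻¹≈ε⇒x≈y; x≈y⇒x∙y⁻¹≈ε; ⁻¹-involutive)

private
  variable
    m n : ℕ

-- Rational numbers

x*y≡0⇒x≡0 : ∀ {x y} → y ≢ 0ℚ → x ℚ.* y ≡ 0ℚ → x ≡ 0ℚ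
x*y≡0⇒x≡0 {x} {y} y≢0 xy≡0 = begin
  x                       ≡⟨ ℚ.*-identityʳ x ⟨
  x ℚ.* 1ℚ                ≡⟨ cong (x ℚ.*_) (ℚ.*-inverseʳ y) ⟨
  x ℚ.* (y ℚ.* (ℚ.1/ y))  ≡⟨ ℚ.*-assoc x y (ℚ.1/ y) ⟨
  x ℚ.* y ℚ.* (ℚ.1/ y)    ≡⟨ cong (ℚ._* (ℚ.1/ y)) xy≡0 ⟩
  0ℚ ℚ.* (ℚ.1/ y)         ≡⟨ ℚ.*-zeroˡ (ℚ.1/ y) ⟩
  0ℚ                      ∎
  where
  open ≡-Reasoning
  instance _ = ℚ.≢-nonZero y≢0

*-≢0 : ∀ {x y} → x ≢ 0ℚ → y ≢ 0ℚ → x ℚ.* y ≢ 0ℚ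
*-≢0 x≢0 y≢0 = x≢0 ∘ x*y≡0⇒x≡0 y≢0

-‿≢0 : ∀ {x} → x ≢ 0ℚ → ℚ.- x ≢ 0ℚ
-‿≢0 {x} x≢0 -x≡0 = x≢0 (trans (sym (⁻¹-involutive x)) (cong ℚ.-_ -x≡0))

-- The form in which polynomial identities are applied: the solver writes an expression as a
-- combination of three quantities, and their vanishing makes it vanish.
combination₃ : ∀ {x y z} p q r → x ≡ 0ℚ → y ≡ 0ℚ → z ≡ 0ℚ →
               p ℚ.* x ℚ.+ q ℚ.* y ℚ.+ r ℚ.* z ≡ 0ℚ
combination₃ p q r refl refl refl =
  cong₂ ℚ._+_ (cong₂ ℚ._+_ (ℚ.*-zeroʳ p) (ℚ.*-zeroʳ q)) (ℚ.*-zeroʳ r)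

fromℕ : ℕ → ℚ
fromℕ n = mkℚ (+ n) 0 (Coprimality.sym (Coprimality.1-coprimeTo n))

fromℕ-injective : fromℕ m ≡ fromℕ n → m ≡ n
fromℕ-injective eq = +-injective (cong ↥_ eq)

-- Polynomial arithmetic

coeff-+ : ∀ p q n → coeff (p + q) n ≡ coeff p n ℚ.+ coeff q n
coeff-+ []      q       n       = sym (ℚ.+-identityˡ _)
coeff-+ (a ∷ p) []      n       = sym (ℚ.+-identityʳ _)
coeff-+ (a ∷ p) (b ∷ q) zero    = refl
coeff-+ (a ∷ p) (b ∷ q) (suc n) = coeff-+ p q n

coeff-map : ∀ a p n → coeff (map (a ℚ.*_) p) n ≡ a ℚ.* coeff p n
coeff-map a []      n       = sym (ℚ.*-zeroʳ a)
coeff-map a (b ∷ p) zero    = refl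
coeff-map a (b ∷ p) (suc n) = coeff-map a p n

coeff-∷* : ∀ a p q n →
           coeff ((a ∷ p) * q) n ≡ a ℚ.* coeff q n ℚ.+ coeff (0ℚ ∷ p * q) n
coeff-∷* a p q n =
  trans (coeff-+ (map (a ℚ.*_) q) _ n) (cong (ℚ._+ _) (coeff-map a q n))

∷-cong : ∀ {a b p q} → a ≡ b → p ≈ q → a ∷ p ≈ b ∷ q
∷-cong a≡b p≈q zero    = a≡b
∷-cong a≡b p≈q (suc n) = p≈q n

∷-zero : ∀ {a p} → a ≡ 0ℚ → p ≈ [] → a ∷ p ≈ []
∷-zero a≡0 p≈0 zero    = a≡0
∷-zero a≡0 p≈0 (suc n) = p≈0 n

*-zeroˡ : ∀ p q → p ≈ [] → p * q ≈ []
*-zeroˡ []      q p≈0 n = refl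
*-zeroˡ (a ∷ p) q p≈0 n = begin
  coeff ((a ∷ p) * q) n                      ≡⟨ coeff-∷* a p q n ⟩
  a ℚ.* coeff q n ℚ.+ coeff (0ℚ ∷ p * q) n
    ≡⟨ cong₂ (λ x y → x ℚ.* coeff q n ℚ.+ y) (p≈0 0) (∷-zero refl (*-zeroˡ p q (p≈0 ∘ suc)) n) ⟩
  0ℚ ℚ.* coeff q n ℚ.+ 0ℚ                    ≡⟨ ℚ.+-identityʳ _ ⟩
  0ℚ ℚ.* coeff q n                           ≡⟨ ℚ.*-zeroˡ (coeff q n) ⟩
  0ℚ                                         ∎
  where open ≡-Reasoning

*-congˡ : ∀ p {q q′} → q ≈ q′ → p * q ≈ p * q′
*-congˡ []      q≈q′ n = refl
*-congˡ (a ∷ p) {q} {q′} q≈q′ n = begin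
  coeff ((a ∷ p) * q) n                       ≡⟨ coeff-∷* a p q n ⟩
  a ℚ.* coeff q n ℚ.+ coeff (0ℚ ∷ p * q) n
    ≡⟨ cong₂ (λ x y → a ℚ.* x ℚ.+ y) (q≈q′ n) (∷-cong refl (*-congˡ p q≈q′) n) ⟩
  a ℚ.* coeff q′ n ℚ.+ coeff (0ℚ ∷ p * q′) n  ≡⟨ coeff-∷* a p q′ n ⟨
  coeff ((a ∷ p) * q′) n                      ∎
  where open ≡-Reasoning

-- Equal polynomials may be lists of different lengths, hence the cases where one list has ended and
-- the other holds only zeros.
*-congʳ : ∀ p p′ q → p ≈ p′ → p * q ≈ p′ * q
*-congʳ []      p′        q p≈p′ n = sym (*-zeroˡ p′ q (sym ∘ p≈p′) n)
*-congʳ (a ∷ p) []        q p≈p′ n = *-zeroˡ (a ∷ p) q p≈p′ n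
*-congʳ (a ∷ p) (a′ ∷ p′) q p≈p′ n = begin
  coeff ((a ∷ p) * q) n                        ≡⟨ coeff-∷* a p q n ⟩
  a ℚ.* coeff q n ℚ.+ coeff (0ℚ ∷ p * q) n
    ≡⟨ cong₂ (λ x y → x ℚ.* coeff q n ℚ.+ y) (p≈p′ 0) (∷-cong refl (*-congʳ p p′ q (p≈p′ ∘ suc)) n) ⟩
  a′ ℚ.* coeff q n ℚ.+ coeff (0ℚ ∷ p′ * q) n   ≡⟨ coeff-∷* a′ p′ q n ⟨
  coeff ((a′ ∷ p′) * q) n                      ∎
  where open ≡-Reasoning

*-zeroʳ : ∀ p {q} → q ≈ [] → p * q ≈ []
*-zeroʳ []      q≈0 n = refl
*-zeroʳ (a ∷ p) {q} q≈0 n = begin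
  coeff ((a ∷ p) * q) n                      ≡⟨ coeff-∷* a p q n ⟩
  a ℚ.* coeff q n ℚ.+ coeff (0ℚ ∷ p * q) n
    ≡⟨ cong₂ (λ x y → a ℚ.* x ℚ.+ y) (q≈0 n) (∷-zero refl (*-zeroʳ p q≈0) n) ⟩
  a ℚ.* 0ℚ ℚ.+ 0ℚ                            ≡⟨ ℚ.+-identityʳ _ ⟩
  a ℚ.* 0ℚ                                   ≡⟨ ℚ.*-zeroʳ a ⟩
  0ℚ                                         ∎
  where open ≡-Reasoning

coeff-∷⟨⟩ : ∀ a p q n →
            coeff ((a ∷ p) ⟨ q ⟩) n ≡ coeff (a ∷ []) n ℚ.+ coeff (q * p ⟨ q ⟩) n
coeff-∷⟨⟩ a p q n = coeff-+ (a ∷ []) (q * p ⟨ q ⟩) n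

∷⟨⟩-cong : ∀ {a a′} p p′ q q′ → a ≡ a′ → q * p ⟨ q ⟩ ≈ q′ * p′ ⟨ q′ ⟩ →
           (a ∷ p) ⟨ q ⟩ ≈ (a′ ∷ p′) ⟨ q′ ⟩
∷⟨⟩-cong {a} p p′ q q′ refl eq n = begin
  coeff ((a ∷ p) ⟨ q ⟩) n                          ≡⟨ coeff-∷⟨⟩ a p q n ⟩
  coeff (a ∷ []) n ℚ.+ coeff (q * p ⟨ q ⟩) n       ≡⟨ cong (coeff (a ∷ []) n ℚ.+_) (eq n) ⟩
  coeff (a ∷ []) n ℚ.+ coeff (q′ * p′ ⟨ q′ ⟩) n    ≡⟨ coeff-∷⟨⟩ a p′ q′ n ⟨
  coeff ((a ∷ p′) ⟨ q′ ⟩) n                        ∎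
  where open ≡-Reasoning

⟨⟩-zero : ∀ p q → p ≈ [] → p ⟨ q ⟩ ≈ []
⟨⟩-zero []      q p≈0 n = refl
⟨⟩-zero (a ∷ p) q p≈0 n = begin
  coeff ((a ∷ p) ⟨ q ⟩) n                          ≡⟨ coeff-∷⟨⟩ a p q n ⟩
  coeff (a ∷ []) n ℚ.+ coeff (q * p ⟨ q ⟩) n
    ≡⟨ cong₂ ℚ._+_ (∷-zero (p≈0 0) (λ _ → refl) n) (*-zeroʳ q (⟨⟩-zero p q (p≈0 ∘ suc)) n) ⟩
  0ℚ                                               ∎
  where open ≡-Reasoning

⟨⟩-congˡ : ∀ p p′ q → p ≈ p′ → p ⟨ q ⟩ ≈ p′ ⟨ q ⟩
⟨⟩-congˡ []      p′        q p≈p′ n = sym (⟨⟩-zero p′ q (sym ∘ p≈p′) n)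
⟨⟩-congˡ (a ∷ p) []        q p≈p′   = ⟨⟩-zero (a ∷ p) q p≈p′
⟨⟩-congˡ (a ∷ p) (a′ ∷ p′) q p≈p′   =
  ∷⟨⟩-cong p p′ q q (p≈p′ 0) (*-congˡ q (⟨⟩-congˡ p p′ q (p≈p′ ∘ suc)))

⟨⟩-congʳ : ∀ p q q′ → q ≈ q′ → p ⟨ q ⟩ ≈ p ⟨ q′ ⟩
⟨⟩-congʳ []      q q′ q≈q′ n = refl
⟨⟩-congʳ (a ∷ p) q q′ q≈q′   = ∷⟨⟩-cong p p q q′ refl λ n →
  trans (*-congˡ q (⟨⟩-congʳ p q q′ q≈q′) n) (*-congʳ q q′ (p ⟨ q′ ⟩) q≈q′ n)

-- Degrees

zero⊎degree : ∀ p → p ≈ [] ⊎ ∃ (HasDegree p)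
zero⊎degree [] = inj₁ λ _ → refl
zero⊎degree (a ∷ p) with zero⊎degree p | a ℚ.≟ 0ℚ
... | inj₂ (n , top , above) | _       = inj₂ (suc n , top , λ { (s≤s n<m) → above n<m })
... | inj₁ p≈0               | yes a≡0 = inj₁ (∷-zero a≡0 p≈0)
... | inj₁ p≈0               | no a≢0  = inj₂ (0 , a≢0 , λ { (s≤s _) → p≈0 _ })

HasDegree-unique : ∀ p q → p ≈ q → HasDegree p m → HasDegree q n → m ≡ n
HasDegree-unique {m} {n} p q p≈q (p-top , p-above) (q-top , q-above) with ℕ.<-cmp m n
... | tri< m<n _ _ = contradiction (trans (sym (p≈q n)) (p-above m<n)) q-top
... | tri≈ _ m≡n _ = m≡n
... | tri> _ _ n<m = contradiction (trans (p≈q m) (q-above n<m)) p-top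

coeff-*-above : ∀ p q → (∀ {i} → m ℕ.< i → coeff p i ≡ 0ℚ) →
                (∀ {i} → n ℕ.< i → coeff q i ≡ 0ℚ) →
                ∀ {i} → m ℕ.+ n ℕ.< i → coeff (p * q) i ≡ 0ℚ
coeff-*-above []      q p-above q-above _ = refl
coeff-*-above {m} {n} (a ∷ p) q p-above q-above {suc i} m+n<i = begin
  coeff ((a ∷ p) * q) (suc i)                  ≡⟨ coeff-∷* a p q (suc i) ⟩
  a ℚ.* coeff q (suc i) ℚ.+ coeff (p * q) i
    ≡⟨ cong₂ (λ x y → a ℚ.* x ℚ.+ y) (q-above (ℕ.≤-<-trans (ℕ.m≤n+m n m) m+n<i)) (tail m p-above m+n<i) ⟩
  a ℚ.* 0ℚ ℚ.+ 0ℚ                              ≡⟨ ℚ.+-identityʳ _ ⟩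
  a ℚ.* 0ℚ                                     ≡⟨ ℚ.*-zeroʳ a ⟩
  0ℚ                                           ∎
  where
  open ≡-Reasoning
  -- Splitting on the bound: for 0 the list `p` is zero, otherwise its bound is one less than that
  -- of `a ∷ p`.
  tail : ∀ m → (∀ {i} → m ℕ.< i → coeff (a ∷ p) i ≡ 0ℚ) → m ℕ.+ n ℕ.< suc i →
         coeff (p * q) i ≡ 0ℚ
  tail zero    p-above _           = *-zeroˡ p q (λ _ → p-above (s≤s z≤n)) i
  tail (suc m) p-above (s≤s m+n<i) = coeff-*-above p q (p-above ∘ s≤s) q-above m+n<i

coeff-*-top : ∀ p q → (∀ {i} → m ℕ.< i → coeff p i ≡ 0ℚ) →
              (∀ {i} → n ℕ.< i → coeff q i ≡ 0ℚ) →
              coeff (p * q) (m ℕ.+ n) ≡ coeff p m ℚ.* coeff q n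
coeff-*-top {m} {n} [] q p-above q-above = sym (ℚ.*-zeroˡ (coeff q n))
coeff-*-top {zero} {n} (a ∷ p) q p-above q-above = begin
  coeff ((a ∷ p) * q) n                        ≡⟨ coeff-∷* a p q n ⟩
  a ℚ.* coeff q n ℚ.+ coeff (0ℚ ∷ p * q) n
    ≡⟨ cong (a ℚ.* coeff q n ℚ.+_) (∷-zero refl (*-zeroˡ p q (λ _ → p-above (s≤s z≤n))) n) ⟩
  a ℚ.* coeff q n ℚ.+ 0ℚ                       ≡⟨ ℚ.+-identityʳ _ ⟩
  a ℚ.* coeff q n                              ∎
  where open ≡-Reasoning
coeff-*-top {suc m} {n} (a ∷ p) q p-above q-above = begin
  coeff ((a ∷ p) * q) (suc m ℕ.+ n)                          ≡⟨ coeff-∷* a p q (suc m ℕ.+ n) ⟩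
  a ℚ.* coeff q (suc m ℕ.+ n) ℚ.+ coeff (p * q) (m ℕ.+ n)
    ≡⟨ cong₂ (λ x y → a ℚ.* x ℚ.+ y) (q-above (s≤s (ℕ.m≤n+m n m))) (coeff-*-top p q (p-above ∘ s≤s) q-above) ⟩
  a ℚ.* 0ℚ ℚ.+ coeff p m ℚ.* coeff q n                       ≡⟨ cong (ℚ._+ _) (ℚ.*-zeroʳ a) ⟩
  0ℚ ℚ.+ coeff p m ℚ.* coeff q n                             ≡⟨ ℚ.+-identityˡ _ ⟩
  coeff p m ℚ.* coeff q n                                    ∎
  where open ≡-Reasoning

HasDegree-* : ∀ p q → HasDegree p m → HasDegree q n → HasDegree (p * q) (m ℕ.+ n)
HasDegree-* p q (p-top , p-above) (q-top , q-above) =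
  *-≢0 p-top q-top ∘ trans (sym (coeff-*-top p q p-above q-above)) ,
  coeff-*-above p q p-above q-above

-- Each Horner step multiplies by `q` and then changes only the constant term, which is not the
-- leading one because `q` has positive degree.
HasDegree-⟨⟩ : ∀ p q → HasDegree p m → HasDegree q (suc n) →
               HasDegree (p ⟨ q ⟩) (m ℕ.* suc n)
HasDegree-⟨⟩ [] q (top , _) _ = contradiction refl top
HasDegree-⟨⟩ {zero} (a ∷ p) q (top , above) _ =
  top ∘ trans (sym (p⟨q⟩≈a 0)) , λ { {suc i} _ → p⟨q⟩≈a (suc i) }
  where
  p⟨q⟩≈a : (a ∷ p) ⟨ q ⟩ ≈ a ∷ []
  p⟨q⟩≈a i = trans (⟨⟩-congˡ (a ∷ p) (a ∷ []) q (∷-cong refl (λ _ → above (s≤s z≤n))) i)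
    (trans (coeff-∷⟨⟩ a [] q i)
      (trans (cong (coeff (a ∷ []) i ℚ.+_) (*-zeroʳ q {[]} (λ _ → refl) i)) (ℚ.+-identityʳ _)))
HasDegree-⟨⟩ {suc m} {n} (a ∷ p) q (top , above) q-deg
  with HasDegree-* q (p ⟨ q ⟩) q-deg (HasDegree-⟨⟩ p q (top , above ∘ s≤s) q-deg)
... | top′ , above′ =
  top′ ∘ trans (sym (positive _)) , λ { (s≤s i<j) → trans (positive _) (above′ (s≤s i<j)) }
  where
  positive : ∀ i → coeff ((a ∷ p) ⟨ q ⟩) (suc i) ≡ coeff (q * p ⟨ q ⟩) (suc i)
  positive i = trans (coeff-∷⟨⟩ a p q (suc i)) (ℚ.+-identityˡ _)

-- Degrees add, so a multiple of `p` is zero or has a nonzero coefficient at a positive index.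
HasDegree⇒∤1 : ∀ p → HasDegree p (suc n) → p ∤ 1#
HasDegree⇒∤1 {n} p p-deg (q , qp≈1) with zero⊎degree q
... | inj₁ q≈0         = contradiction (trans (sym (qp≈1 0)) (*-zeroˡ q p q≈0 0)) λ ()
... | inj₂ (m , q-deg) =
  proj₁ (HasDegree-* q p q-deg p-deg)
    (trans (qp≈1 (m ℕ.+ suc n)) (cong (coeff 1#) (ℕ.+-suc m n)))

product⇒Reducible : ∀ p a b → HasDegree a (suc m) → HasDegree b (suc n) →
                    p ≈ a * b → Reducible p
product⇒Reducible p a b a-deg b-deg p≈ab =
  (λ p≈0 → proj₁ (HasDegree-* a b a-deg b-deg) (trans (sym (p≈ab _)) (p≈0 _))) ,
  a , b , HasDegree⇒∤1 a a-deg , HasDegree⇒∤1 b b-deg , p≈ab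

-- Identities in the coefficients

-- The formulas are needed both for rationals and for solver expressions.
module Formulas (R : RawRing 0ℓ 0ℓ) where
  open RawRing R using () renaming (Carrier to X; _+_ to _⊕_; _*_ to _∙_; -_ to ⊝_; 1# to 𝟙)

  infixl 6 _⊖_
  _⊖_ : X → X → X
  x ⊖ y = x ⊕ ⊝ y

  𝟚 𝟛 𝟜 : X
  𝟚 = 𝟙 ⊕ 𝟙
  𝟛 = 𝟙 ⊕ 𝟚
  𝟜 = 𝟚 ⊕ 𝟚

  -- the Taylor coefficients at k of a + bt + ct² + t³
  jet₀ jet₁ jet₂ : X → X → X → X → X
  jet₀ a b c k = a ⊕ b ∙ k ⊕ c ∙ (k ∙ k) ⊕ k ∙ (k ∙ k)
  jet₁ a b c k = b ⊕ 𝟚 ∙ (c ∙ k) ⊕ 𝟛 ∙ (k ∙ k)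
  jet₂ a b c k = c ⊕ 𝟛 ∙ k

  -- y³ m(x / y) for m = a + bt + ct² + t³
  homogenized : X → X → X → X → X → X
  homogenized a b c x y =
    a ∙ (y ∙ (y ∙ y)) ⊕ b ∙ (x ∙ (y ∙ y)) ⊕ c ∙ ((x ∙ x) ∙ y) ⊕ x ∙ (x ∙ x)

  cubic : X → X → X → X → List X
  cubic d a b c = d ∙ a ∷ d ∙ b ∷ d ∙ c ∷ d ∷ []

  linearFactor : X → List X
  linearFactor r = ⊝ r ∷ 𝟙 ∷ []

  quadraticCofactor : X → X → X → X → List X
  quadraticCofactor d b c r = d ∙ (b ⊕ c ∙ r ⊕ r ∙ r) ∷ d ∙ (c ⊕ r) ∷ d ∷ []

  module _ (a b c k : X) where
    private
      A = jet₀ a b c k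
      B = jet₁ a b c k
      C = jet₂ a b c k

    quadratic factor : List X
    quadratic = k ⊖ C ∷ ⊝ B ∷ ⊝ A ∷ []
    factor    = 𝟙 ∷ C ∷ B ∷ A ∷ []

    -- With s = g - k one has H = 1 - sy and C + s = -(B + Ay)y, so A + Bs + Cs² + s³ = (1 - sy)(A +
    -- (B + Ay)s). The second factor, times d, is the cofactor.
    cofactor : X → List X
    cofactor d = d ∙ (A ⊖ B ∙ C) ∷ ⊝ d ∙ (A ∙ C ⊕ B ∙ B) ∷
                 ⊝ d ∙ (𝟚 ∙ (A ∙ B)) ∷ ⊝ d ∙ (A ∙ A) ∷ []

  -- With A, B, C the Taylor coefficients at j, the residues are the coefficients
  -- of g_j(v + uy) − g_(j + δ).
  module _ (A B C δ u v : X) where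
    residue₀ residue₁ residue₂ : X
    residue₀ = 𝟚 ∙ δ ⊖ (A ∙ (v ∙ v) ⊕ B ∙ v)
    residue₁ = jet₁ A B C δ ⊖ (𝟚 ∙ (A ∙ (u ∙ v)) ⊕ B ∙ u)
    residue₂ = jet₀ A B C δ ⊖ A ∙ (u ∙ u)

    -- `residue₀` is 2δ - v · `slope`. For A ≠ 0 the symmetry y ↦ -B/A - y of g_j replaces v by
    -- -`slope`/A and u by -u; up to the factor -A it carries `case₁` to `case₂`.
    slope : X
    slope = A ∙ v ⊕ B

    -- The values of q₁ and q₂ at the midpoint, up to a nonzero factor.  If case₁
    -- vanishes, q₁ also vanishes at j + 2/v; if case₂ vanishes, q₂ also vanishes
    -- at j − 2A/slope.
    case₁ case₂ : X
    case₁ = 𝟚 ∙ u ⊕ 𝟚 ⊖ v ∙ δ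
    case₂ = 𝟚 ∙ (A ∙ (u ⊖ 𝟙)) ⊖ slope ∙ δ

open +-*-Solver

expressionRawRing : ℕ → RawRing 0ℓ 0ℓ
expressionRawRing n = record
  { Carrier = Polynomial n
  ; _≈_     = _≡_
  ; _+_     = _:+_
  ; _*_     = _:*_
  ; -_      = :-_
  ; 0#      = con 0ℚ
  ; 1#      = con 1ℚ
  }

open Formulas ℚ.+-*-rawRing
module E {n} = Formulas (expressionRawRing n)

-- Polynomial arithmetic on solver expressions, mirroring the definitions for
-- rationals so that it evaluates to them.
module _ {n : ℕ} where
  infixl 6 _⊞_
  _⊞_ : List (Polynomial n) → List (Polynomial n) → List (Polynomial n)
  []      ⊞ q       = q
  (a ∷ p) ⊞ []      = a ∷ p
  (a ∷ p) ⊞ (b ∷ q) = (a :+ b) ∷ (p ⊞ q)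

  infixl 7 _⊠_
  _⊠_ : List (Polynomial n) → List (Polynomial n) → List (Polynomial n)
  []      ⊠ q = []
  (a ∷ p) ⊠ q = map (a :*_) q ⊞ (con 0ℚ ∷ (p ⊠ q))

  infixl 8 _⟪_⟫
  _⟪_⟫ : List (Polynomial n) → List (Polynomial n) → List (Polynomial n)
  []      ⟪ q ⟫ = []
  (a ∷ p) ⟪ q ⟫ = (a ∷ []) ⊞ q ⊠ (p ⟪ q ⟫)

  coeffᴱ : List (Polynomial n) → ℕ → Polynomial n
  coeffᴱ []      n       = con 0ℚ
  coeffᴱ (a ∷ p) zero    = a
  coeffᴱ (a ∷ p) (suc n) = coeffᴱ p n

jet₀-shift : ∀ a b c k s →
             jet₀ (jet₀ a b c k) (jet₁ a b c k) (jet₂ a b c k) s ≡ jet₀ a b c (k ℚ.+ s)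
jet₀-shift = solve 5 (λ a b c k s →
  E.jet₀ (E.jet₀ a b c k) (E.jet₁ a b c k) (E.jet₂ a b c k) s := E.jet₀ a b c (k :+ s)) refl

-- Scaling by 1/y turns a zero into the rational root x/y. With the denominator cleared, the later
-- identities stay polynomial.
homogenized-≢0 : ∀ a b c → (∀ s → jet₀ a b c s ≢ 0ℚ) →
                 ∀ x {y} → y ≢ 0ℚ → homogenized a b c x y ≢ 0ℚ
homogenized-≢0 a b c no-root x {y} y≢0 eq = no-root (x ℚ.* w) (begin
  jet₀ a b c (x ℚ.* w)
    ≡⟨ solve 4 (λ a b c s → E.jet₀ a b c s := E.homogenized a b c s (con 1ℚ)) refl a b c (x ℚ.* w) ⟩
  homogenized a b c (x ℚ.* w) 1ℚ
    ≡⟨ cong (homogenized a b c (x ℚ.* w)) (ℚ.*-inverseʳ y) ⟨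
  homogenized a b c (x ℚ.* w) (y ℚ.* w)
    ≡⟨ solve 6 (λ a b c x y w → E.homogenized a b c (x :* w) (y :* w)
         := w :* (w :* w) :* E.homogenized a b c x y) refl a b c x y w ⟩
  w ℚ.* (w ℚ.* w) ℚ.* homogenized a b c x y
    ≡⟨ cong (w ℚ.* (w ℚ.* w) ℚ.*_) eq ⟩
  w ℚ.* (w ℚ.* w) ℚ.* 0ℚ
    ≡⟨ ℚ.*-zeroʳ (w ℚ.* (w ℚ.* w)) ⟩
  0ℚ ∎)
  where
  open ≡-Reasoning
  instance _ = ℚ.≢-nonZero y≢0
  w = ℚ.1/ y

cubic-remainder : ∀ d a b c r → cubic d a b c ≈
                  linearFactor r * quadraticCofactor d b c r + (d ℚ.* jet₀ a b c r ∷ [])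
cubic-remainder d a b c r = λ where
    0 → solve 5 (identity 0) refl d a b c r
    1 → solve 5 (identity 1) refl d a b c r
    2 → solve 5 (identity 2) refl d a b c r
    3 → solve 5 (identity 3) refl d a b c r
    (suc (suc (suc (suc n)))) → refl
  where
  identity : ℕ → (d a b c r : Polynomial 5) → Polynomial 5 × Polynomial 5
  identity n d a b c r = coeffᴱ (E.cubic d a b c) n
    := coeffᴱ (E.linearFactor r ⊠ E.quadraticCofactor d b c r ⊞ (d :* E.jet₀ a b c r ∷ [])) n

cubic-⟨quadratic⟩ : ∀ d a b c k → cubic d a b c ⟨ quadratic a b c k ⟩
                    ≈ factor a b c k * cofactor a b c k d
cubic-⟨quadratic⟩ d a b c k = λ where
    0 → solve 5 (identity 0) refl d a b c k
    1 → solve 5 (identity 1) refl d a b c k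
    2 → solve 5 (identity 2) refl d a b c k
    3 → solve 5 (identity 3) refl d a b c k
    4 → solve 5 (identity 4) refl d a b c k
    5 → solve 5 (identity 5) refl d a b c k
    6 → solve 5 (identity 6) refl d a b c k
    -- The composite has degree 6, but Horner's rule yields a list of nine entries, whose last two
    -- vanish only after simplification.
    7 → solve 5 (identity 7) refl d a b c k
    8 → solve 5 (identity 8) refl d a b c k
    (suc (suc (suc (suc (suc (suc (suc (suc (suc n))))))))) → refl
  where
  identity : ℕ → (d a b c k : Polynomial 5) → Polynomial 5 × Polynomial 5
  identity n d a b c k = coeffᴱ (E.cubic d a b c ⟪ E.quadratic a b c k ⟫) n
    := coeffᴱ (E.factor a b c k ⊠ E.cofactor a b c k d) n

-- Inequivalence under affine substitutions

-- Vanishing residues force `case₁` or `case₂` to vanish, and either one yields a rational root of A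
-- + Bs + Cs² + s³.
residues-≢0 : ∀ A B C δ u v → (∀ s → jet₀ A B C s ≢ 0ℚ) → δ ≢ 0ℚ →
              residue₀ A B C δ u v ≡ 0ℚ → residue₁ A B C δ u v ≡ 0ℚ →
              residue₂ A B C δ u v ≡ 0ℚ → ⊥
residues-≢0 A B C δ u v no-root δ≢0 r₀≡0 r₁≡0 r₂≡0 = *-≢0 case₁≢0 case₂≢0 case₁*case₂≡0
  where
  N = slope A B C δ u v

  -- `residue₀` = 0 says vN = 2δ, so the roots 2/v and -2A/N below are well defined.
  v*N≢0 : v ℚ.* N ≢ 0ℚ
  v*N≢0 v*N≡0 = *-≢0 {𝟚} (λ ()) δ≢0 (trans
    (solve 6 (λ A B C δ u v → E.𝟚 :* δ :=
      con 1ℚ :* E.residue₀ A B C δ u v :+ con 1ℚ :* (v :* E.slope A B C δ u v)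
        :+ con 0ℚ :* con 0ℚ) refl A B C δ u v)
    (combination₃ 1ℚ 1ℚ 0ℚ r₀≡0 v*N≡0 refl))

  v≢0 : v ≢ 0ℚ
  v≢0 v≡0 = v*N≢0 (trans (cong (ℚ._* N) v≡0) (ℚ.*-zeroˡ N))

  N≢0 : N ≢ 0ℚ
  N≢0 N≡0 = v*N≢0 (trans (cong (v ℚ.*_) N≡0) (ℚ.*-zeroʳ v))

  -- Up to a nonzero factor this is q₁q₂ at the midpoint, written as an explicit combination of the
  -- residues.
  case₁*case₂≡0 : case₁ A B C δ u v ℚ.* case₂ A B C δ u v ≡ 0ℚ
  case₁*case₂≡0 = trans
    (solve 6 (λ A B C δ u v → E.case₁ A B C δ u v :* E.case₂ A B C δ u v :=
      :- (δ :* δ) :* E.residue₀ A B C δ u v :+ E.𝟚 :* δ :* E.residue₁ A B C δ u v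
        :+ :- E.𝟜 :* E.residue₂ A B C δ u v) refl A B C δ u v)
    (combination₃ (ℚ.- (δ ℚ.* δ)) (𝟚 ℚ.* δ) (ℚ.- 𝟜) r₀≡0 r₁≡0 r₂≡0)

  -- Measured from j, the roots of q₁ have product δ/v; if one is the midpoint δ/2, the other is
  -- 2/v.
  case₁≢0 : case₁ A B C δ u v ≢ 0ℚ
  case₁≢0 case₁≡0 = homogenized-≢0 A B C no-root 𝟚 v≢0 (x*y≡0⇒x≡0 δ≢0 (trans
    (solve 6 (λ A B C δ u v → E.homogenized A B C E.𝟚 v :* δ :=
      (E.𝟜 :- E.𝟛 :* (v :* δ)) :* E.residue₀ A B C δ u v
        :+ E.𝟚 :* v :* E.residue₁ A B C δ u v
        :+ (E.𝟚 :* (A :* (v :* v)) :+ B :* v) :* E.case₁ A B C δ u v) refl A B C δ u v)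
    (combination₃ (𝟜 ℚ.- 𝟛 ℚ.* (v ℚ.* δ)) (𝟚 ℚ.* v) (𝟚 ℚ.* (A ℚ.* (v ℚ.* v)) ℚ.+ B ℚ.* v)
      r₀≡0 r₁≡0 case₁≡0)))

  -- The same with -N/A in place of v: the other root is -2A/N.
  case₂≢0 : case₂ A B C δ u v ≢ 0ℚ
  case₂≢0 case₂≡0 = homogenized-≢0 A B C no-root (ℚ.- (𝟚 ℚ.* A)) N≢0 (x*y≡0⇒x≡0 δ≢0 (trans
    (solve 6 (λ A B C δ u v → let N = E.slope A B C δ u v in
      E.homogenized A B C (:- (E.𝟚 :* A)) N :* δ :=
      :- (A :* (E.𝟜 :* (A :* (A :* u)) :+ N :* δ :* A)) :* E.residue₀ A B C δ u v
        :+ E.𝟚 :* (A :* (A :* N)) :* E.residue₁ A B C δ u v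
        :+ A :* (E.𝟜 :* (A :* δ) :+ B :* N) :* E.case₂ A B C δ u v) refl A B C δ u v)
    (combination₃ (ℚ.- (A ℚ.* (𝟜 ℚ.* (A ℚ.* (A ℚ.* u)) ℚ.+ N ℚ.* δ ℚ.* A)))
      (𝟚 ℚ.* (A ℚ.* (A ℚ.* N))) (A ℚ.* (𝟜 ℚ.* (A ℚ.* δ) ℚ.+ B ℚ.* N))
      r₀≡0 r₁≡0 case₂≡0)))

-- Recentring at j, with δ = i - j: a root s of the recentred cubic would give the root j + s of m.
quadratic-≉ : ∀ a b c {i j} → (∀ s → jet₀ a b c s ≢ 0ℚ) → i ≢ j →
              ∀ u v → ¬ quadratic a b c i ≈ quadratic a b c j ⟨ v ∷ u ∷ [] ⟩
quadratic-≉ a b c {i} {j} no-root i≢j u v eq =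
  residues-≢0 (jet₀ a b c j) (jet₁ a b c j) (jet₂ a b c j) (i ℚ.- j) u v
    (λ s → no-root (j ℚ.+ s) ∘ trans (sym (jet₀-shift a b c j s)))
    (i≢j ∘ x∙y⁻¹≈ε⇒x≈y i j)
    (trans (solve 7 (identity E.residue₀ 0) refl a b c i j u v) (difference 0))
    (trans (solve 7 (identity E.residue₁ 1) refl a b c i j u v) (difference 1))
    (trans (solve 7 (identity E.residue₂ 2) refl a b c i j u v) (difference 2))
  where
  difference : ∀ n → coeff (quadratic a b c j ⟨ v ∷ u ∷ [] ⟩) n
               ℚ.- coeff (quadratic a b c i) n ≡ 0ℚ
  difference n = x≈y⇒x∙y⁻¹≈ε (sym (eq n))

  identity : ((A B C δ u v : Polynomial 7) → Polynomial 7) → ℕ →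
             (a b c i j u v : Polynomial 7) → Polynomial 7 × Polynomial 7
  identity residue n a b c i j u v =
    residue (E.jet₀ a b c j) (E.jet₁ a b c j) (E.jet₂ a b c j) (i :- j) u v :=
    coeffᴱ (E.quadratic a b c j ⟪ v ∷ u ∷ [] ⟫) n :- coeffᴱ (E.quadratic a b c i) n

-- Reduction to affine substitutions

above-1⇒≈ : ∀ p → (∀ {m} → 1 ℕ.< m → coeff p m ≡ 0ℚ) →
            p ≈ coeff p 0 ∷ coeff p 1 ∷ []
above-1⇒≈ p above 0             = refl
above-1⇒≈ p above 1             = refl
above-1⇒≈ p above (suc (suc n)) = above (s≤s (s≤s z≤n))

quadratic-degree : ∀ a b c k → jet₀ a b c k ≢ 0ℚ → HasDegree (quadratic a b c k) 2
quadratic-degree a b c k A≢0 = -‿≢0 A≢0 , λ { (s≤s (s≤s (s≤s _))) → refl }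

-- For nonconstant p the degree of h(p) is 2 deg p, and comparison with deg g = 2 gives deg p = 1.
inner-above-1 : ∀ p g h → HasDegree g 2 → HasDegree h 2 → g ≈ h ⟨ p ⟩ →
                ∀ {m} → 1 ℕ.< m → coeff p m ≡ 0ℚ
inner-above-1 p g h g-deg h-deg g≈h⟨p⟩ {m} 1<m with zero⊎degree p
... | inj₁ p≈0                  = p≈0 _
... | inj₂ (zero , _ , above)   = above (ℕ.<-trans (s≤s z≤n) 1<m)
... | inj₂ (suc n , p-deg@(_ , above)) = above (subst (ℕ._< m) 1≡1+n 1<m)
  where
  1≡1+n : 1 ≡ suc n
  1≡1+n = ℕ.*-cancelˡ-≡ 1 (suc n) 2
    (HasDegree-unique g (h ⟨ p ⟩) g≈h⟨p⟩ g-deg (HasDegree-⟨⟩ h p h-deg p-deg))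

-- Irreducible cubics

-- At a root the remainder of division by t - r vanishes, leaving a product of two factors of
-- positive degree.
cubic-no-root : ∀ f d a b c → Irreducible f → f ≈ cubic d a b c → d ≢ 0ℚ →
                ∀ r → jet₀ a b c r ≢ 0ℚ
cubic-no-root f d a b c f-irr f≈ d≢0 r root =
  [ HasDegree⇒∤1 (linearFactor r) linear-degree
  , HasDegree⇒∤1 (quadraticCofactor d b c r) cofactor-degree ]
    (Algebra.Definitions.RawSemiring.Irreducible.split-∣1 f-irr f≈product)
  where
  linear-degree : HasDegree (linearFactor r) 1
  linear-degree = (λ ()) , λ { (s≤s (s≤s _)) → refl }

  cofactor-degree : HasDegree (quadraticCofactor d b c r) 2
  cofactor-degree = d≢0 , λ { (s≤s (s≤s (s≤s _))) → refl }

  f≈product : f ≈ linearFactor r * quadraticCofactor d b c r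
  f≈product n = begin
    coeff f n                                  ≡⟨ f≈ n ⟩
    coeff (cubic d a b c) n                    ≡⟨ cubic-remainder d a b c r n ⟩
    coeff (product + (d ℚ.* jet₀ a b c r ∷ [])) n
      ≡⟨ coeff-+ product (d ℚ.* jet₀ a b c r ∷ []) n ⟩
    coeff product n ℚ.+ coeff (d ℚ.* jet₀ a b c r ∷ []) n
      ≡⟨ cong (coeff product n ℚ.+_) (∷-zero (trans (cong (d ℚ.*_) root) (ℚ.*-zeroʳ d)) (λ _ → refl) n) ⟩
    coeff product n ℚ.+ 0ℚ                     ≡⟨ ℚ.+-identityʳ _ ⟩
    coeff product n                            ∎
    where
    open ≡-Reasoning
    product = linearFactor r * quadraticCofactor d b c r

-- Keeping the leading coefficient as an outer factor lets the coefficient identities work with a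
-- monic m.
degree-3⇒cubic : ∀ f → HasDegree f 3 →
                 ∃ λ d → ∃ λ a → ∃ λ b → ∃ λ c → d ≢ 0ℚ × f ≈ cubic d a b c
degree-3⇒cubic f (d≢0 , above) =
  d , ratio 0 , ratio 1 , ratio 2 , d≢0 , λ where
    0 → scale 0
    1 → scale 1
    2 → scale 2
    3 → refl
    (suc (suc (suc (suc n)))) → above (s≤s (s≤s (s≤s (s≤s z≤n))))
  where
  d = coeff f 3
  instance _ = ℚ.≢-nonZero d≢0

  ratio : ℕ → ℚ
  ratio n = (ℚ.1/ d) ℚ.* coeff f n

  scale : ∀ n → coeff f n ≡ d ℚ.* ratio n
  scale n = begin
    coeff f n                           ≡⟨ ℚ.*-identityˡ _ ⟨
    1ℚ ℚ.* coeff f n                    ≡⟨ cong (ℚ._* coeff f n) (ℚ.*-inverseʳ d) ⟨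
    d ℚ.* (ℚ.1/ d) ℚ.* coeff f n        ≡⟨ ℚ.*-assoc d (ℚ.1/ d) _ ⟩
    d ℚ.* ratio n                       ∎
    where open ≡-Reasoning

-- The infinite family of quadratics

theorem3p2 : (f : ℚ[X]) → Irreducible f → HasDegree f 3 →
    ∃ λ (g : ℕ → ℚ[X]) →
    (∀ i → HasDegree (g i) 2 × Reducible (f ⟨ g i ⟩)) ×
    (∀ i j → i ≢ j → ¬ (∃ λ (p : ℚ[X]) → g i ≈ g j ⟨ p ⟩))
theorem3p2 f f-irr f-deg with degree-3⇒cubic f f-deg
... | d , a , b , c , d≢0 , f≈cubic = g , (λ i → g-degree i , f⟨g⟩-reducible i) , distinct
  where
  no-root : ∀ r → jet₀ a b c r ≢ 0ℚ
  no-root = cubic-no-root f d a b c f-irr f≈cubic d≢0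

  -- The leading coefficient at k is -m(k), nonzero since m has no rational root, so every natural
  -- number is an admissible parameter.
  g : ℕ → ℚ[X]
  g k = quadratic a b c (fromℕ k)

  g-degree : ∀ k → HasDegree (g k) 2
  g-degree k = quadratic-degree a b c (fromℕ k) (no-root (fromℕ k))

  f⟨g⟩-reducible : ∀ k → Reducible (f ⟨ g k ⟩)
  f⟨g⟩-reducible k = product⇒Reducible (f ⟨ g k ⟩) (factor a b c κ) (cofactor a b c κ d)
    factor-degree cofactor-degree
    λ n → trans (⟨⟩-congˡ f (cubic d a b c) (g k) f≈cubic n) (cubic-⟨quadratic⟩ d a b c κ n)
    where
    κ   = fromℕ k
    A≢0 = no-root κ

    factor-degree : HasDegree (factor a b c κ) 3
    factor-degree = A≢0 , λ { (s≤s (s≤s (s≤s (s≤s _)))) → refl }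

    cofactor-degree : HasDegree (cofactor a b c κ d) 3
    cofactor-degree =
      *-≢0 (-‿≢0 d≢0) (*-≢0 A≢0 A≢0) , λ { (s≤s (s≤s (s≤s (s≤s _)))) → refl }

  distinct : ∀ i j → i ≢ j → ¬ (∃ λ (p : ℚ[X]) → g i ≈ g j ⟨ p ⟩)
  distinct i j i≢j (p , gᵢ≈gⱼ⟨p⟩) =
    quadratic-≉ a b c no-root (i≢j ∘ fromℕ-injective) (coeff p 1) (coeff p 0) λ n →
      trans (gᵢ≈gⱼ⟨p⟩ n) (⟨⟩-congʳ (g j) p (coeff p 0 ∷ coeff p 1 ∷ [])
        (above-1⇒≈ p (inner-above-1 p (g i) (g j) (g-degree i) (g-degree j) gᵢ≈gⱼ⟨p⟩)) n)
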